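{- Let $N_m=3^m+1$ for $m\ge1$. (1) The subset $Y$ of the $3$-adic Cantor set $\Sigma_{3,\bar2}$ given by $$Y:=\Big\{\lambda=\sum_{j=0}^\infty a_j3^j:\ \text{all } a_{2k}\in\{0,1\},\ \text{all } a_{2k+1}=0\Big\}\subset\mathbb{Z}_3$$ is a $3$-adic path set fractal having $\dim_H(Y)=\frac12\log_3 2\approx0.315464$. This set satisfies $Y\subset\mathcal{C}(1,N_{2k+1})$ for all $k\ge0$, and in consequence $$Y\subseteq\bigcap_{k=1}^\infty\mathcal{C}(1,N_{2k+1}).$$ (2) One has $$\dim_H\Big(\{\lambda\in\Sigma_{3,\bar2}:N_{2k+1}\lambda\in\Sigma_{3,\bar2}\ \text{for all } k\ge0\}\Big)\ge\dim_H(Y)=\tfrac12\log_3 2.$$ Therefore $\dim_H(\mathcal{E}_\star(\mathbb{Z}_3))\ge\frac12\log_3 2\approx 0.315464$.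
   Context: $\mathbb{Z}_3$ denotes the $3$-adic integers with the $3$-adic metric ($|3|_3=1/3$), and $\dim_H$ is Hausdorff dimension with respect to it. $\Sigma_{3,\bar2}\subset\mathbb{Z}_3$ is the set of all $\sum_{j\ge0}a_j3^j$ with every $a_j\in\{0,1\}$. For an integer $M\ge1$, $\mathcal{C}(1,M)=\{\lambda\in\Sigma_{3,\bar2}:M\lambda\in\Sigma_{3,\bar2}\}$. The $3$-adic generalized exceptional set $\mathcal{E}_\star(\mathbb{Z}_3)$ is the set of $\lambda\in\mathbb{Z}_3$ such that there are infinitely many integers $M\ge1$ with $M\not\equiv0\pmod3$, including $M=1$, for which $M\lambda\in\Sigma_{3,\bar2}$. A $3$-adic path set fractal is a set $K\subset\mathbb{Z}_3$ for which there is a finite directed graph with edges labeled by symbols in $\{0,1,2\}$ (loops and multiple edges allowed) and a marked vertex $v$ such that $K$ is the set of all $\sum_{j\ge0}a_j3^j$ where $(a_0,a_1,\ldots)$ ranges over the sequences of successive labels of infinite directed walks starting at $v$. -}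

module Defs where

open import Level using (Level; 0ℓ; _⊔_) renaming (suc to lsuc)
open import Data.Nat.Base as ℕ using (ℕ; zero; suc; z≤n; s≤s; _^_)
import Data.Nat.Properties as ℕ
open import Data.Nat.Divisibility using () renaming (_∣_ to _∣ℕ_)
open import Data.Nat.Solver using (module +-*-Solver)
open import Data.Integer.Base as ℤ using (ℤ; +_; +[1+_]; ∣_∣; +<+)
import Data.Integer.Properties as ℤ
open import Data.Integer.Divisibility.Signed using (_∣_; ∣n⇒∣m*n; ∣-refl)
open import Data.Rational.Unnormalised.Base as ℚ
  using (ℚᵘ; mkℚᵘ; 0ℚᵘ; 1ℚᵘ; ½; ↥_; ↧ₙ_; *<*; *≡*; _/_)
import Data.Rational.Unnormalised.Properties as ℚ
open import Data.Fin.Base using (Fin; toℕ)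
open import Data.Fin.Patterns using (0F; 1F)
open import Data.Product using (∃-syntax; Σ-syntax; _×_; _,_)
open import Data.Sum.Base using (_⊎_)
open import Relation.Nullary using (¬_; contradiction)
open import Relation.Unary using (Pred; _∈_; _⊆_; _≐_; Empty)
open import Relation.Binary.PropositionalEquality
  using (_≡_; refl; sym; trans; cong; subst; subst₂)
open import Algebra.Definitions.RawSemiring ℚ.+-*-rawSemiring
  using () renaming (_^_ to _^ℚ_)

private variable
  ℓ ℓ₁ ℓ₂ : Level

-- A number x ∈ [-∞, +∞] is given by the set { q ∈ ℚ : x < q }.  Classically
-- every open up-closed set of rationals arises from exactly one such x.

record ℝ̅ (ℓ : Level) : Set (lsuc ℓ) where
  field
    above    : Pred ℚᵘ ℓ
    upClosed : ∀ {p q} → p ℚ.< q → p ∈ above → q ∈ above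
    rounded  : ∀ {q} → q ∈ above → ∃[ p ] p ℚ.< q × p ∈ above

open ℝ̅ public

infix 4 _≤ᴿ_ _≈ᴿ_ _<ℚ_

_≤ᴿ_ : ℝ̅ ℓ₁ → ℝ̅ ℓ₂ → Set (ℓ₁ ⊔ ℓ₂)
x ≤ᴿ y = above y ⊆ above x

_≈ᴿ_ : ℝ̅ ℓ₁ → ℝ̅ ℓ₂ → Set (ℓ₁ ⊔ ℓ₂)
x ≈ᴿ y = x ≤ᴿ y × y ≤ᴿ x

_<ℚ_ : ℝ̅ ℓ → ℚᵘ → Set ℓ
x <ℚ q = q ∈ above x

fromℚ : ℚᵘ → ℝ̅ 0ℓ
fromℚ q = record
  { above    = q ℚ.<_
  ; upClosed = λ p<r q<p → ℚ.<-trans q<p p<r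
  ; rounded  = λ q<r → let m , q<m , m<r = ℚ.<-dense q<r in m , m<r , q<m
  }

-- x < 2q  if and only if  x/2 < q.

half : ℝ̅ ℓ → ℝ̅ ℓ
half x = record
  { above    = λ q → 2ℚ ℚ.* q ∈ above x
  ; upClosed = λ p<q → upClosed x (ℚ.*-monoʳ-<-pos 2ℚ p<q)
  ; rounded  = λ {q} 2q∈x →
      let p , p<2q , p∈x = rounded x 2q∈x
          m , p<m , m<2q = ℚ.<-dense p<2q
      in ½ ℚ.* m
       , ℚ.<-respʳ-≃ (½2≃ q) (ℚ.*-monoʳ-<-pos ½ m<2q)
       , upClosed x (ℚ.<-respʳ-≃ (ℚ.≃-sym (2½≃ m)) p<m) p∈x
  }
  where
  2ℚ : ℚᵘ
  2ℚ = + 2 / 1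
  ½2≃ : ∀ q → ½ ℚ.* (2ℚ ℚ.* q) ℚ.≃ q
  ½2≃ q = ℚ.≃-trans (ℚ.≃-sym (ℚ.*-assoc ½ 2ℚ q))
            (ℚ.≃-trans (ℚ.*-congʳ {q} {½ ℚ.* 2ℚ} {1ℚᵘ} (*≡* refl)) (ℚ.*-identityˡ q))
  2½≃ : ∀ q → 2ℚ ℚ.* (½ ℚ.* q) ℚ.≃ q
  2½≃ q = ℚ.≃-trans (ℚ.≃-sym (ℚ.*-assoc 2ℚ ½ q))
            (ℚ.≃-trans (ℚ.*-congʳ {q} {2ℚ ℚ.* ½} {1ℚᵘ} (*≡* refl)) (ℚ.*-identityˡ q))

-- For q = a/b > 0:  log₃ 2 < q  iff  2 < 3^(a/b)  iff  2^b < 3^a.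

log₃2 : ℝ̅ 0ℓ
log₃2 = record
  { above    = Above
  ; upClosed = up
  ; rounded  = op
  }
  where
  open import Data.Nat.Base using (_+_; _*_; _≤_; _<_)

  Above : Pred ℚᵘ 0ℓ
  Above q = 0ℚᵘ ℚ.< q × 2 ^ (↧ₙ q) < 3 ^ ∣ ↥ q ∣

  up : ∀ {p q} → p ℚ.< q → Above p → Above q
  up {mkℚᵘ (+ a) b-1} {mkℚᵘ (+ c) d-1} (*<* lt) (0<p , 2ᵇ<3ᵃ) =
    ℚ.<-trans 0<p (*<* lt) , ℕ.≰⇒> λ 3ᶜ≤2ᵈ → ℕ.<-irrefl refl (begin-strict
      2 ^ (d * b)     ≡⟨ cong (2 ^_) (ℕ.*-comm d b) ⟩
      2 ^ (b * d)     ≡⟨ sym (ℕ.^-*-assoc 2 b d) ⟩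
      (2 ^ b) ^ d     <⟨ ℕ.^-monoˡ-< d 2ᵇ<3ᵃ ⟩
      (3 ^ a) ^ d     ≡⟨ ℕ.^-*-assoc 3 a d ⟩
      3 ^ (a * d)     ≤⟨ ℕ.^-monoʳ-≤ 3 (ℕ.<⇒≤ ad<cb) ⟩
      3 ^ (c * b)     ≡⟨ sym (ℕ.^-*-assoc 3 c b) ⟩
      (3 ^ c) ^ b     ≤⟨ ℕ.^-monoˡ-≤ b 3ᶜ≤2ᵈ ⟩
      (2 ^ d) ^ b     ≡⟨ ℕ.^-*-assoc 2 d b ⟩
      2 ^ (d * b)     ∎)
    where
    open ℕ.≤-Reasoning
    b d : ℕ
    b = suc b-1
    d = suc d-1
    ad<cb : a * d < c * b
    ad<cb = ℤ.drop‿+<+ (subst₂ ℤ._<_ (sym (ℤ.pos-* a d)) (sym (ℤ.pos-* c b)) lt)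
  up {mkℚᵘ (ℤ.-[1+ _ ]) _} {_} _ (*<* () , _)
  up {mkℚᵘ (+ _) _} {mkℚᵘ (ℤ.-[1+ _ ]) _} p<q (0<p , _) with ℚ.<-trans 0<p p<q
  ... | *<* ()

  bernoulli : ∀ B n → B ^ n * (B + n) ≤ B * (suc B) ^ n
  bernoulli B zero    = ℕ.≤-reflexive (solve 1 (λ B → con 1 :* (B :+ con 0) := B :* con 1) refl B)
    where open +-*-Solver
  bernoulli B (suc n) = begin
    B * P * (B + suc n)                      ≤⟨ ℕ.m≤m+n _ (P * n) ⟩
    B * P * (B + suc n) + P * n              ≡⟨ solve 3 (λ B P n →
        B :* P :* (B :+ (con 1 :+ n)) :+ P :* n := (con 1 :+ B) :* (P :* (B :+ n))) refl B P n ⟩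
    suc B * (P * (B + n))                    ≤⟨ ℕ.*-monoʳ-≤ (suc B) (bernoulli B n) ⟩
    suc B * (B * suc B ^ n)                  ≡⟨ solve 2 (λ B Q →
        (con 1 :+ B) :* (B :* Q) := B :* ((con 1 :+ B) :* Q)) refl B (suc B ^ n) ⟩
    B * suc B ^ suc n                        ∎
    where
    open ℕ.≤-Reasoning
    open +-*-Solver
    P : ℕ
    P = B ^ n

  gap : ∀ A B .{{_ : ℕ.NonZero B}} → B < A → let n = suc (3 * B) in 3 * B ^ n < A ^ n
  gap A B B<A = ℕ.*-cancelˡ-< B _ _ (begin-strict
    B * (3 * B ^ n)          ≡⟨ solve 2 (λ B P → B :* (con 3 :* P) := P :* (con 3 :* B)) refl B (B ^ n) ⟩
    B ^ n * (3 * B)          <⟨ ℕ.*-monoʳ-< (B ^ n) {{ℕ.m^n≢0 B n}} (ℕ.m≤n+m n B) ⟩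
    B ^ n * (B + n)          ≤⟨ bernoulli B n ⟩
    B * (suc B) ^ n          ≤⟨ ℕ.*-monoʳ-≤ B (ℕ.^-monoˡ-≤ n B<A) ⟩
    B * A ^ n                ∎)
    where
    open ℕ.≤-Reasoning
    open +-*-Solver
    n : ℕ
    n = suc (3 * B)

  lower : ∀ a b-1 m c → c ≡ suc m * a → 3 * 2 ^ (suc m * suc b-1) < 3 ^ c →
          ∃[ p ] p ℚ.< mkℚᵘ (+ a) b-1 × Above p
  lower a b-1 m zero       _ h = contradiction
    (ℕ.≤-trans (ℕ.m^n>0 2 (suc m * suc b-1)) (ℕ.m≤n*m _ 3)) (ℕ.<⇒≱ h)
  lower a b-1 m (suc zero) _ h = contradiction
    (ℕ.*-monoʳ-≤ 3 (ℕ.m^n>0 2 (suc m * suc b-1))) (ℕ.<⇒≱ h)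
  lower a b-1 m (suc (suc k)) eq h =
      mkℚᵘ +[1+ k ] (b-1 + m * suc b-1)
    , *<* (subst₂ ℤ._<_ (ℤ.pos-* (suc k) b) (ℤ.pos-* a (suc m * b)) (+<+ (begin-strict
        suc k * b             <⟨ ℕ.*-monoˡ-< b (ℕ.n<1+n (suc k)) ⟩
        suc (suc k) * b       ≡⟨ cong (_* b) eq ⟩
        suc m * a * b         ≡⟨ cong (_* b) (ℕ.*-comm (suc m) a) ⟩
        a * suc m * b         ≡⟨ ℕ.*-assoc a (suc m) b ⟩
        a * (suc m * b)       ∎)))
    , ℚ.positive⁻¹ (mkℚᵘ +[1+ k ] (b-1 + m * suc b-1))
    , ℕ.*-cancelˡ-< 3 _ _ h
    where
    open ℕ.≤-Reasoning
    b : ℕ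
    b = suc b-1

  op : ∀ {q} → Above q → ∃[ p ] p ℚ.< q × Above p
  op {mkℚᵘ (ℤ.-[1+ _ ]) _} (*<* () , _)
  op {mkℚᵘ (+ a) b-1} (_ , 2ᵇ<3ᵃ) = lower a b-1 (3 * B) (n * a) refl (begin-strict
    3 * 2 ^ (n * b)    ≡⟨ cong (λ e → 3 * 2 ^ e) (ℕ.*-comm n b) ⟩
    3 * 2 ^ (b * n)    ≡⟨ cong (3 *_) (sym (ℕ.^-*-assoc 2 b n)) ⟩
    3 * B ^ n          <⟨ gap (3 ^ a) B {{ℕ.m^n≢0 2 b}} 2ᵇ<3ᵃ ⟩
    (3 ^ a) ^ n        ≡⟨ ℕ.^-*-assoc 3 a n ⟩
    3 ^ (a * n)        ≡⟨ cong (3 ^_) (ℕ.*-comm a n) ⟩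
    3 ^ (n * a)        ∎)
    where
    open ℕ.≤-Reasoning
    b B n : ℕ
    b = suc b-1
    B = 2 ^ b
    n = suc (3 * B)

-- ℤ₃ is the inverse limit of the rings ℤ/3ⁿ; residue n represents the
-- class modulo 3ⁿ.

record ℤ₃ : Set where
  field
    residue  : ℕ → ℤ
    coherent : ∀ n → + (3 ^ n) ∣ residue (suc n) ℤ.- residue n

open ℤ₃ public

infix 4 ∣_-_∣₃≤3^-_ _≈_

∣_-_∣₃≤3^-_ : ℤ₃ → ℤ₃ → ℕ → Set
∣ x - y ∣₃≤3^- n = + (3 ^ n) ∣ residue x n ℤ.- residue y n

_≈_ : ℤ₃ → ℤ₃ → Set
x ≈ y = ∀ n → ∣ x - y ∣₃≤3^- n

infixr 7 _·_

_·_ : ℕ → ℤ₃ → ℤ₃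
M · x = record
  { residue  = λ n → + M ℤ.* residue x n
  ; coherent = λ n → subst (+ (3 ^ n) ∣_)
      (distrib (+ M) (residue x (suc n)) (residue x n))
      (∣n⇒∣m*n (+ M) (coherent x n))
  }
  where
  distrib : ∀ a b c → a ℤ.* (b ℤ.- c) ≡ a ℤ.* b ℤ.- a ℤ.* c
  distrib a b c = trans (ℤ.*-distribˡ-+ a b (ℤ.- c))
    (cong (λ z → a ℤ.* b ℤ.+ z) (sym (ℤ.neg-distribʳ-* a c)))

Digits : Set
Digits = ℕ → Fin 3

digitSum : Digits → ℕ → ℕ
digitSum a zero    = 0
digitSum a (suc n) = digitSum a n ℕ.+ toℕ (a n) ℕ.* 3 ^ n

Σ3^ : Digits → ℤ₃
Σ3^ a = record
  { residue  = λ n → + digitSum a n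
  ; coherent = λ n → subst (+ (3 ^ n) ∣_) (sym (step n)) (∣n⇒∣m*n (+ toℕ (a n)) ∣-refl)
  }
  where
  step : ∀ n → + digitSum a (suc n) ℤ.- + digitSum a n ≡ + toℕ (a n) ℤ.* + (3 ^ n)
  step n = trans (ℤ.m-n≡m⊖n (digitSum a (suc n)) (digitSum a n))
    (trans (ℤ.⊖-≥ (ℕ.m≤m+n (digitSum a n) _))
      (trans (cong +_ (ℕ.m+n∸m≡n (digitSum a n) _)) (ℤ.pos-* (toℕ (a n)) (3 ^ n))))

Diam_≤3^-_ : Pred ℤ₃ ℓ → ℕ → Set ℓ
Diam U ≤3^- n = ∀ x y → x ∈ U → y ∈ U → ∣ x - y ∣₃≤3^- n

-- [3^- n ]^ s ≤ r means (3⁻ⁿ)ˢ ≤ r for real s ≥ 0.  As t ↦ (3⁻ⁿ)ᵗ is continuous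
-- and non-increasing, it is enough that (3⁻ⁿ)^(a/b) ≤ r, i.e. 1 ≤ 3^(na) r^b, for all a/b > s.

[3^-_]^_≤_ : ℕ → ℝ̅ 0ℓ → ℚᵘ → Set
[3^- n ]^ s ≤ r = 0ℚᵘ ℚ.≤ r ×
  (∀ q → s <ℚ q → 1ℚᵘ ℚ.≤ (+ (3 ^ (n ℕ.* ∣ ↥ q ∣)) / 1) ℚ.* r ^ℚ (↧ₙ q))

∑< : ℕ → (ℕ → ℚᵘ) → ℚᵘ
∑< zero    r = 0ℚᵘ
∑< (suc n) r = ∑< n r ℚ.+ r n

-- ℋˢ(X) = lim_{δ→0} inf { Σᵢ (diam Uᵢ)ˢ : X ⊆ ⋃ᵢ Uᵢ, diam Uᵢ ≤ δ } vanishes.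
-- Here δ = 3⁻ᵐ, and rᵢ is a rational upper bound of (diam Uᵢ)ˢ.  Empty Uᵢ, which
-- contribute 0, allow for finite covers.  The Uᵢ need not respect ≈; closing them
-- under ≈ does not change their diameters.

ℋ[_]_≡0 : ℝ̅ 0ℓ → Pred ℤ₃ ℓ → Set (lsuc 0ℓ ⊔ ℓ)
ℋ[ s ] X ≡0 = ∀ (m : ℕ) (ε : ℚᵘ) → 0ℚᵘ ℚ.< ε →
  Σ[ U ∈ (ℕ → Pred ℤ₃ 0ℓ) ] Σ[ r ∈ (ℕ → ℚᵘ) ]
    (∀ x → x ∈ X → ∃[ i ] x ∈ U i) ×
    (∀ i → (Empty (U i) × 0ℚᵘ ℚ.≤ r i) ⊎
           (∃[ n ] m ℕ.≤ n × Diam (U i) ≤3^- n × [3^- n ]^ s ≤ r i)) ×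
    (∀ N → ∑< N r ℚ.≤ ε)

-- dim_H X = inf { s ≥ 0 : ℋˢ(X) = 0 }

dimH : Pred ℤ₃ ℓ → ℝ̅ (lsuc 0ℓ ⊔ ℓ)
dimH X = record
  { above    = λ q → Σ[ s ∈ ℝ̅ 0ℓ ] fromℚ 0ℚᵘ ≤ᴿ s × ℋ[ s ] X ≡0 × s <ℚ q
  ; upClosed = λ { p<q (s , 0≤s , null , s<p) → s , 0≤s , null , upClosed s p<q s<p }
  ; rounded  = λ { (s , 0≤s , null , s<q) →
      let p , p<q , s<p = rounded s s<q in p , p<q , s , 0≤s , null , s<p }
  }

record LabelledGraph : Set where
  field
    #vertices #edges : ℕ
    source target    : Fin #edges → Fin #vertices
    label            : Fin #edges → Fin 3

  IsWalkFrom : Fin #vertices → (ℕ → Fin #edges) → Set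
  IsWalkFrom v e = source (e 0) ≡ v × (∀ j → target (e j) ≡ source (e (suc j)))

  pathSet : Fin #vertices → Pred ℤ₃ 0ℓ
  pathSet v x = Σ[ e ∈ (ℕ → Fin #edges) ] IsWalkFrom v e × x ≈ Σ3^ (λ j → label (e j))

IsPathSetFractal : Pred ℤ₃ ℓ → Set ℓ
IsPathSetFractal K = Σ[ G ∈ LabelledGraph ] ∃[ v ] K ≐ LabelledGraph.pathSet G v

Is01 : Fin 3 → Set
Is01 d = d ≡ 0F ⊎ d ≡ 1F

Cantor : Pred ℤ₃ 0ℓ
Cantor x = Σ[ a ∈ Digits ] (∀ j → Is01 (a j)) × x ≈ Σ3^ a

𝒞[1,_] : ℕ → Pred ℤ₃ 0ℓ
𝒞[1, M ] x = x ∈ Cantor × M · x ∈ Cantor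

-- Infinitely many M, expressed as unboundedly many.

ℰ⋆ : Pred ℤ₃ 0ℓ
ℰ⋆ x = Good 1 × (∀ n → ∃[ M ] n ℕ.< M × Good M)
  where
  Good : ℕ → Set
  Good M = 1 ℕ.≤ M × ¬ (3 ∣ℕ M) × M · x ∈ Cantor

N : ℕ → ℕ
N m = 3 ^ m ℕ.+ 1

Y : Pred ℤ₃ 0ℓ
Y x = Σ[ a ∈ Digits ]
  (∀ k → Is01 (a (2 ℕ.* k))) × (∀ k → a (2 ℕ.* k ℕ.+ 1) ≡ 0F) × x ≈ Σ3^ a

-- Part (1): 1 + 3ᵐ with m odd acts on Y without carries, because the digits of λ sit at
-- even places and those of 3ᵐ λ at odd places.
--
-- Upper bound: for log₃ 2 < 2a/b and n = 2bt, the 2^(bt) cylinders of Y of diameter 3⁻ⁿ have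
-- total a/b-dimensional size (2^b / 3^(2a))^t, which tends to 0.
--
-- Lower bound: if 3^(2a) ≤ 2^b, a set of diameter 3⁻ⁿ meets Y inside a cylinder given by
-- ⌈n/2⌉ bits, whose mass 2^(-⌈n/2⌉) is at most the size charged for that set.  So a covering
-- of total size ≤ 1/2 would have mass ≤ 1/2; but choosing bit after bit the half in which the
-- relative mass of the covering stays ≤ 1/2 leads to a point of Y that is not covered.
-- Excluded middle makes this choice, and no compactness argument is needed.

module Submission where

open import Level using (Level; 0ℓ)
open import Axiom.ExcludedMiddle using (ExcludedMiddle)
open import Algebra.Bundles using (module CommutativeMonoid)
open import Algebra.Properties.CommutativeSemigroup using (interchange)
open import Data.Bool.Base using (Bool; true; false)
open import Data.Fin.Base using (Fin; toℕ)
open import Data.Fin.Patterns using (0F; 1F; 2F)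
import Data.Fin.Properties as Fin
open import Data.Integer.Base as ℤ using (+_; +[1+_]; ∣_∣)
open import Data.Integer.Divisibility.Signed as ∣ using (_∣_; divides)
import Data.Integer.Properties as ℤ
open import Data.Integer.Solver using () renaming (module +-*-Solver to ℤ-Solver)
open import Data.List.Base using (List; []; _∷_)
open import Data.Maybe.Base using (Maybe; just; nothing)
open import Data.Nat.Base as ℕ using
  (ℕ; zero; suc; NonZero; >-nonZero; _≤_; _<_; _+_; _*_; _∸_; _^_; ⌊_/2⌋; ⌈_/2⌉; z≤n; s≤s)
import Data.Nat.Divisibility as ℕ∣
open import Data.Nat.Divisibility using () renaming (_∣_ to _∣ℕ_)
import Data.Nat.DivMod as ℕ
import Data.Nat.Properties as ℕ
open import Data.Nat.Solver using (module +-*-Solver)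
open import Data.Product using (∃-syntax; Σ-syntax; _×_; _,_; proj₁; proj₂)
open import Data.Rational.Unnormalised.Base as ℚ
  using (ℚᵘ; mkℚᵘ; 0ℚᵘ; 1ℚᵘ; ½; ↥_; ↧ₙ_; *<*; *≤*; *≡*; _/_)
import Data.Rational.Unnormalised.Properties as ℚ
open import Data.Sum.Base using (_⊎_; inj₁; inj₂)
open import Data.Unit.Base using (tt)
open import Function.Base using (_∘_)
open import Relation.Binary.PropositionalEquality
  using (_≡_; refl; sym; trans; cong; cong₂; subst; subst₂; module ≡-Reasoning)
open import Relation.Nullary using (¬_; Dec; yes; no; contradiction)
open import Relation.Nullary.Decidable using (toWitness)
open import Relation.Unary using (Pred; _∈_; _⊆_; Empty)
open import Algebra.Definitions.RawSemiring ℚ.+-*-rawSemiring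
  using () renaming (_^_ to _^ℚ_)
open import Defs

private variable
  ℓ ℓ′ : Level

-- Digit expansions

∣-minus-trans : ∀ {d} i j k → d ∣ i ℤ.- j → d ∣ j ℤ.- k → d ∣ i ℤ.- k
∣-minus-trans {d} i j k d∣i-j d∣j-k = subst (d ∣_) (telescope i j k) (∣.∣m∣n⇒∣m+n d∣i-j d∣j-k)
  where
  telescope : ∀ i j k → (i ℤ.- j) ℤ.+ (j ℤ.- k) ≡ i ℤ.- k
  telescope = solve 3 (λ i j k → (i :- j) :+ (j :- k) := i :- k) refl
    where open ℤ-Solver

∣-minus-sym : ∀ {d} i j → d ∣ i ℤ.- j → d ∣ j ℤ.- i
∣-minus-sym {d} i j d∣i-j = subst (d ∣_)
  (solve 2 (λ i j → :- (i :- j) := j :- i) refl i j) (∣.∣m⇒∣-m d∣i-j)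
  where open ℤ-Solver

≈-trans : ∀ {x y z} → x ≈ y → y ≈ z → x ≈ z
≈-trans {x} {y} {z} x≈y y≈z n =
  ∣-minus-trans (residue x n) (residue y n) (residue z n) (x≈y n) (y≈z n)

·-cong : ∀ M {x y} → x ≈ y → M · x ≈ M · y
·-cong M {x} {y} x≈y n = subst (+ (3 ^ n) ∣_)
  (solve 3 (λ a b c → a :* (b :- c) := a :* b :- a :* c) refl (+ M) (residue x n) (residue y n))
  (∣.∣n⇒∣m*n (+ M) (x≈y n))
  where open ℤ-Solver

≡mod⇒∣ : ∀ {d i j} t → i ≡ j + t * d → + d ∣ + i ℤ.- + j
≡mod⇒∣ {d} {i} {j} t refl = divides (+ t) (begin
  + (j + t * d) ℤ.- + j          ≡⟨ ℤ.[+m]-[+n]≡m⊖n (j + t * d) j ⟩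
  (j + t * d) ℤ.⊖ j              ≡⟨ ℤ.⊖-≥ (ℕ.m≤m+n j (t * d)) ⟩
  + (j + t * d ∸ j)       ≡⟨ cong +_ (ℕ.m+n∸m≡n j (t * d)) ⟩
  + (t * d)                      ≡⟨ ℤ.pos-* t d ⟩
  + t ℤ.* + d                    ∎)
  where open ≡-Reasoning

digitSum-cong : ∀ {a b} → (∀ j → a j ≡ b j) → ∀ n → digitSum a n ≡ digitSum b n
digitSum-cong a≗b zero    = refl
digitSum-cong a≗b (suc n) =
  cong₂ (λ s d → s + toℕ d * 3 ^ n) (digitSum-cong a≗b n) (a≗b n)

Σ3^-cong : ∀ {a b} → (∀ j → a j ≡ b j) → Σ3^ a ≈ Σ3^ b
Σ3^-cong a≗b n = ≡mod⇒∣ 0 (trans (digitSum-cong a≗b n) (sym (ℕ.+-identityʳ _)))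

-- `digitSum` adds digits at the top, whereas shifting, the base 9 reading and the recovery of bits
-- proceed from the lowest digit. This passes from one recursion to the other.
digitSum-front : ∀ a n → digitSum a (suc n) ≡ toℕ (a 0) + 3 * digitSum (a ∘ suc) n
digitSum-front a zero    = trans (ℕ.*-identityʳ _) (sym (ℕ.+-identityʳ _))
digitSum-front a (suc n) = begin
  digitSum a (suc n) + d * (3 * 3 ^ n)    ≡⟨ cong (_+ d * (3 * 3 ^ n)) (digitSum-front a n) ⟩
  a₀ + 3 * s + d * (3 * 3 ^ n)            ≡⟨ solve 4 (λ a₀ s d p →
      a₀ :+ con 3 :* s :+ d :* (con 3 :* p) := a₀ :+ con 3 :* (s :+ d :* p)) refl a₀ s d (3 ^ n) ⟩
  a₀ + 3 * (s + d * 3 ^ n)                ∎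
  where
  open ≡-Reasoning
  open +-*-Solver
  a₀ d s : ℕ
  a₀ = toℕ (a 0)
  d = toℕ (a (suc n))
  s = digitSum (a ∘ suc) n

infixr 5 _◃_

_◃_ : Fin 3 → Digits → Digits
(d ◃ a) zero    = d
(d ◃ a) (suc j) = a j

-- The digits of `3 ^ m` times the number with digits `a`.
shift : ℕ → Digits → Digits
shift zero    a = a
shift (suc m) a = 0F ◃ shift m a

-- The number `t` collects the digits that the shift pushes past the first `n` places.
digitSum-shift : ∀ m a n → ∃[ t ] 3 ^ m * digitSum a n ≡ digitSum (shift m a) n + t * 3 ^ n
digitSum-shift zero    a n       = 0 , refl
digitSum-shift (suc m) a zero    = 0 , ℕ.*-zeroʳ (3 ^ suc m)
digitSum-shift (suc m) a (suc n) with digitSum-shift m a (suc n)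
-- One more shift moves the digit of `shift m a` at place `n` to place `suc n`, beyond the cutoff,
-- so it joins the quotient.
... | t , eq = 3 * t + toℕ (shift m a n) , (begin
  3 * 3 ^ m * S                          ≡⟨ ℕ.*-assoc 3 (3 ^ m) S ⟩
  3 * (3 ^ m * S)                        ≡⟨ cong (3 *_) eq ⟩
  3 * (s + d * p + t * (3 * p))          ≡⟨ solve 4 (λ s d p t →
      con 3 :* (s :+ d :* p :+ t :* (con 3 :* p)) :=
      con 3 :* s :+ (con 3 :* t :+ d) :* (con 3 :* p)) refl s d p t ⟩
  3 * s + (3 * t + d) * (3 * p)          ≡⟨ cong (_+ (3 * t + d) * (3 * p)) (sym (digitSum-front (shift (suc m) a) n)) ⟩
  digitSum (shift (suc m) a) (suc n) + (3 * t + d) * 3 ^ suc n ∎)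
  where
  open ≡-Reasoning
  open +-*-Solver
  S s d p : ℕ
  S = digitSum a (suc n)
  s = digitSum (shift m a) n
  d = toℕ (shift m a n)
  p = 3 ^ n

infixl 6 _⊕_

-- The sum of two digits of which one is zero, hence without carry. For two nonzero digits the first
-- serves as a default, which keeps the digits 0 and 1 closed under `⊕`.
_⊕_ : Fin 3 → Fin 3 → Fin 3
0F ⊕ e = e
d  ⊕ e = d

toℕ-⊕ : ∀ d e → d ≡ 0F ⊎ e ≡ 0F → toℕ (d ⊕ e) ≡ toℕ d + toℕ e
toℕ-⊕ 0F e _           = refl
toℕ-⊕ 1F e (inj₂ refl) = refl
toℕ-⊕ 2F e (inj₂ refl) = refl

is01-⊕ : ∀ {d e} → Is01 d → Is01 e → Is01 (d ⊕ e)
is01-⊕ (inj₁ refl) e01 = e01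
is01-⊕ (inj₂ refl) _   = inj₂ refl

digitSum-⊕ : ∀ a b → (∀ j → a j ≡ 0F ⊎ b j ≡ 0F) → ∀ n →
             digitSum (λ j → a j ⊕ b j) n ≡ digitSum a n + digitSum b n
digitSum-⊕ a b disjoint zero    = refl
digitSum-⊕ a b disjoint (suc n) = begin
  digitSum (λ j → a j ⊕ b j) n + toℕ (a n ⊕ b n) * p  ≡⟨ cong₂ (λ s d → s + d * p)
      (digitSum-⊕ a b disjoint n) (toℕ-⊕ (a n) (b n) (disjoint n)) ⟩
  s + t + (d + e) * p                                ≡⟨ solve 5 (λ s t d e p →
      s :+ t :+ (d :+ e) :* p := (s :+ d :* p) :+ (t :+ e :* p)) refl s t d e p ⟩
  (s + d * p) + (t + e * p)                          ∎
  where
  open ≡-Reasoning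
  open +-*-Solver
  p s t d e : ℕ
  p = 3 ^ n
  s = digitSum a n
  t = digitSum b n
  d = toℕ (a n)
  e = toℕ (b n)

-- Multiplication by `3 ^ m + 1` adds the number to its own shift. Disjoint supports let the digits
-- be added place by place, and the overflow of the shift is a multiple of `3 ^ n`.
N·Σ3^ : ∀ m a → (∀ j → a j ≡ 0F ⊎ shift m a j ≡ 0F) →
        N m · Σ3^ a ≈ Σ3^ (λ j → a j ⊕ shift m a j)
N·Σ3^ m a disjoint n with digitSum-shift m a n
... | t , eq = subst (λ i → + (3 ^ n) ∣ i ℤ.- + digitSum b n) (ℤ.pos-* (N m) S) (≡mod⇒∣ t (begin
  (3 ^ m + 1) * S                          ≡⟨ ℕ.*-distribʳ-+ S (3 ^ m) 1 ⟩
  3 ^ m * S + 1 * S                        ≡⟨ cong (_+ 1 * S) eq ⟩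
  s + t * 3 ^ n + 1 * S                    ≡⟨ solve 3 (λ s S u →
      s :+ u :+ con 1 :* S := S :+ s :+ u) refl s S (t * 3 ^ n) ⟩
  S + s + t * 3 ^ n                        ≡⟨ cong (_+ t * 3 ^ n) (sym (digitSum-⊕ a (shift m a) disjoint n)) ⟩
  digitSum b n + t * 3 ^ n                 ∎))
  where
  open ≡-Reasoning
  open +-*-Solver
  b : Digits
  b j = a j ⊕ shift m a j
  S s : ℕ
  S = digitSum a n
  s = digitSum (shift m a) n

-- Parity of digit positions

even⊎odd : ∀ j → ∃[ k ] (j ≡ 2 * k ⊎ j ≡ 2 * k + 1)
even⊎odd zero          = 0 , inj₁ refl
even⊎odd (suc zero)    = 0 , inj₂ refl
even⊎odd (suc (suc j)) with even⊎odd j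
... | k , inj₁ refl = suc k , inj₁ (sym (ℕ.*-suc 2 k))
... | k , inj₂ refl = suc k , inj₂ (cong (_+ 1) (sym (ℕ.*-suc 2 k)))

2k+1≡suc2k : ∀ k → 2 * k + 1 ≡ suc (2 * k)
2k+1≡suc2k k = ℕ.+-comm (2 * k) 1

EvenZero OddZero : Digits → Set
EvenZero a = ∀ k → a (2 * k) ≡ 0F
OddZero  a = ∀ k → a (2 * k + 1) ≡ 0F

-- Each prepended digit exchanges even and odd places, so even shifts preserve the parity of the
-- support and odd shifts reverse it.
◃-oddZero : ∀ d {a} → EvenZero a → OddZero (d ◃ a)
◃-oddZero d {a} even k = trans (cong (d ◃ a) (2k+1≡suc2k k)) (even k)

◃-evenZero : ∀ {a} → OddZero a → EvenZero (0F ◃ a)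
◃-evenZero     odd zero    = refl
◃-evenZero {a} odd (suc k) = trans (cong (0F ◃ a) (trans (ℕ.*-suc 2 k) (cong suc (sym (2k+1≡suc2k k))))) (odd k)

shift-even : ∀ k {a} → OddZero a → OddZero (shift (2 * k) a)
shift-even zero    odd = odd
shift-even (suc k) {a} odd = subst (λ m → OddZero (shift m a)) (sym (ℕ.*-suc 2 k))
  (◃-oddZero 0F (◃-evenZero (shift-even k odd)))

shift-odd : ∀ k {a} → OddZero a → EvenZero (shift (2 * k + 1) a)
shift-odd k {a} odd = subst (λ m → EvenZero (shift m a)) (sym (2k+1≡suc2k k))
  (◃-evenZero (shift-even k odd))

shift-is01 : ∀ m {a} → (∀ j → Is01 (a j)) → ∀ j → Is01 (shift m a j)
shift-is01 zero    a01 j       = a01 j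
shift-is01 (suc m) a01 zero    = inj₁ refl
shift-is01 (suc m) a01 (suc j) = shift-is01 m a01 j

oddZero⇒is01 : ∀ {a} → (∀ k → Is01 (a (2 * k))) → OddZero a → ∀ j → Is01 (a j)
oddZero⇒is01 even01 odd j with even⊎odd j
... | k , inj₁ refl = even01 k
... | k , inj₂ refl = inj₁ (odd k)

oddZero-evenZero-disjoint : ∀ {a b} → OddZero a → EvenZero b → ∀ j → a j ≡ 0F ⊎ b j ≡ 0F
oddZero-evenZero-disjoint odd even j with even⊎odd j
... | k , inj₁ refl = inj₂ (even k)
... | k , inj₂ refl = inj₁ (odd k)

-- `Y` inside the Cantor set and the exceptional set

Y⊆Cantor : Y ⊆ Cantor
Y⊆Cantor (a , even01 , odd0 , x≈a) = a , oddZero⇒is01 even01 odd0 , x≈a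

-- For m odd, a and its shift by m have disjoint supports, so λ and 3ᵐ λ add without carries.
N·Y⊆Cantor : ∀ k {x} → x ∈ Y → N (2 * k + 1) · x ∈ Cantor
N·Y⊆Cantor k {x} (a , even01 , odd0 , x≈a) =
    (λ j → a j ⊕ shift m a j)
  , (λ j → is01-⊕ (a01 j) (shift-is01 m a01 j))
  , ≈-trans {N m · x} {N m · Σ3^ a} {Σ3^ (λ j → a j ⊕ shift m a j)}
      (·-cong (N m) {x} {Σ3^ a} x≈a)
      (N·Σ3^ m a (oddZero-evenZero-disjoint odd0 (shift-odd k odd0)))
  where
  m : ℕ
  m = 2 * k + 1
  a01 : ∀ j → Is01 (a j)
  a01 = oddZero⇒is01 even01 odd0

Cantor-1· : ∀ {x} → x ∈ Cantor → 1 · x ∈ Cantor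
Cantor-1· {x} (a , a01 , x≈a) = a , a01 , λ n →
  subst (λ i → + (3 ^ n) ∣ i ℤ.- + digitSum a n) (sym (ℤ.*-identityˡ (residue x n))) (x≈a n)

-- Otherwise 3, a divisor of `3 ^ suc m`, would divide the remaining summand 1.
3∤N : ∀ m → ¬ (3 ∣ℕ N (suc m))
3∤N m 3∣N = contradiction
  (ℕ∣.∣⇒≤ (ℕ∣.∣m+n∣m⇒∣n 3∣N (ℕ∣.∣m⇒∣m*n (3 ^ m) ℕ∣.∣-refl))) λ { (s≤s ()) }

m<N[m] : ∀ m → m < N m
m<N[m] zero    = s≤s z≤n
m<N[m] (suc m) = begin-strict
  suc m             <⟨ s≤s (m<N[m] m) ⟩
  suc (3 ^ m + 1)   ≡⟨ ℕ.+-comm 1 (3 ^ m + 1) ⟩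
  3 ^ m + 1 + 1     ≤⟨ ℕ.+-monoˡ-≤ 1 (ℕ.+-monoʳ-≤ (3 ^ m) (ℕ.≤-trans (ℕ.m^n>0 3 m) (ℕ.m≤m+n (3 ^ m) _))) ⟩
  3 ^ suc m + 1     ∎
  where open ℕ.≤-Reasoning

Y⊆ℰ⋆ : Y ⊆ ℰ⋆
Y⊆ℰ⋆ {x} x∈Y =
    (s≤s z≤n , (λ 3∣1 → contradiction (ℕ∣.∣⇒≤ 3∣1) λ { (s≤s ()) }) , Cantor-1· {x} (Y⊆Cantor {x} x∈Y))
  -- An odd exponent that is at least `n`; then `N m` exceeds `m` and so `n`.
  , λ n → let m = 2 * n + 1 in
      N m
    , ℕ.≤-<-trans (ℕ.≤-trans (ℕ.m≤n*m n 2) (ℕ.m≤m+n (2 * n) 1)) (m<N[m] m)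
    , ℕ.m≤n+m 1 (3 ^ m)
    , subst (λ l → ¬ (3 ∣ℕ N l)) (sym (2k+1≡suc2k n)) (3∤N (2 * n))
    , N·Y⊆Cantor n {x} x∈Y

-- `Y` as a path set

Y-graph : LabelledGraph
Y-graph = record
  { #vertices = 2
  ; #edges    = 3
  -- Vertex `0F` stands for even places and `1F` for odd ones. Edges `0F` and `1F` carry the free
  -- digit, edge `2F` the forced zero on the way back.
  ; source    = λ { 0F → 0F ; 1F → 0F ; 2F → 1F }
  ; target    = λ { 0F → 1F ; 1F → 1F ; 2F → 0F }
  ; label     = λ { 0F → 0F ; 1F → 1F ; 2F → 0F }
  }

open LabelledGraph Y-graph using (source; target; label; IsWalkFrom; pathSet)

-- The edges out of vertex `0F` are numbered by their labels, so a digit 0 or 1 at an even place is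
-- itself the edge to take.
edges : Digits → ℕ → Fin 3
edges a zero          = a 0
edges a (suc zero)    = 2F
edges a (suc (suc j)) = edges (a ∘ suc ∘ suc) j

drop2-even : ∀ {a : Digits} → (∀ k → Is01 (a (2 * k))) → ∀ k → Is01 (a (suc (suc (2 * k))))
drop2-even {a} h k = subst (Is01 ∘ a) (ℕ.*-suc 2 k) (h (suc k))

drop2-odd : ∀ {a : Digits} → OddZero a → OddZero (a ∘ suc ∘ suc)
drop2-odd {a} h k = trans (cong a (cong (_+ 1) (sym (ℕ.*-suc 2 k)))) (h (suc k))

edges-walk : ∀ {a} → (∀ k → Is01 (a (2 * k))) → IsWalkFrom 0F (edges a)
edges-walk {a} even01 = start a even01 , step a even01
  where
  start : ∀ a → (∀ k → Is01 (a (2 * k))) → source (edges a 0) ≡ 0F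
  start a even01 with a 0 | even01 0
  ... | _ | inj₁ refl = refl
  ... | _ | inj₂ refl = refl
  step : ∀ a → (∀ k → Is01 (a (2 * k))) → ∀ j → target (edges a j) ≡ source (edges a (suc j))
  step a even01 zero          with a 0 | even01 0
  ... | _ | inj₁ refl = refl
  ... | _ | inj₂ refl = refl
  step a even01 (suc zero)    = sym (start (a ∘ suc ∘ suc) (drop2-even {a} even01))
  step a even01 (suc (suc j)) = step (a ∘ suc ∘ suc) (drop2-even {a} even01) j

label-edges : ∀ {a} → (∀ k → Is01 (a (2 * k))) → OddZero a → ∀ j → a j ≡ label (edges a j)
label-edges {a} even01 odd0 zero with a 0 | even01 0
... | _ | inj₁ refl = refl
... | _ | inj₂ refl = refl
label-edges     even01 odd0 (suc zero)    = odd0 0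
label-edges {a} even01 odd0 (suc (suc j)) = label-edges (drop2-even {a} even01) (drop2-odd {a} odd0) j

source0⇒ : ∀ {e} → source e ≡ 0F → Is01 (label e) × target e ≡ 1F
source0⇒ {0F} _ = inj₁ refl , refl
source0⇒ {1F} _ = inj₂ refl , refl
source0⇒ {2F} ()

source1⇒ : ∀ {e} → source e ≡ 1F → label e ≡ 0F × target e ≡ 0F
source1⇒ {2F} _ = refl , refl

walk-even : ∀ {e} → IsWalkFrom 0F e → ∀ k → source (e (2 * k)) ≡ 0F
walk-even (start , step) zero = start
walk-even {e} w@(_ , step) (suc k) = subst (λ j → source (e j) ≡ 0F) (sym (ℕ.*-suc 2 k))
  (trans (sym (step (suc (2 * k))))
    (proj₂ (source1⇒ (trans (sym (step (2 * k))) (proj₂ (source0⇒ (walk-even w k)))))))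

walk-odd : ∀ {e} → IsWalkFrom 0F e → ∀ k → source (e (2 * k + 1)) ≡ 1F
walk-odd {e} w@(_ , step) k = subst (λ j → source (e j) ≡ 1F) (sym (2k+1≡suc2k k))
  (trans (sym (step (2 * k))) (proj₂ (source0⇒ (walk-even w k))))

Y-isPathSetFractal : IsPathSetFractal Y
Y-isPathSetFractal = Y-graph , 0F ,
    (λ { {x} (a , even01 , odd0 , x≈a) →
         edges a , edges-walk even01 ,
         ≈-trans {x} {Σ3^ a} {Σ3^ (label ∘ edges a)} x≈a (Σ3^-cong (label-edges even01 odd0)) })
  , (λ { (e , w , x≈) → label ∘ e
       , (λ k → proj₁ (source0⇒ (walk-even w k)))
       , (λ k → proj₁ (source1⇒ (walk-odd w k)))
       , x≈ })

-- Fractions of natural numbers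

/-mono-≤ : ∀ m n p q .{{_ : NonZero n}} .{{_ : NonZero q}} →
           m * q ≤ p * n → + m / n ℚ.≤ + p / q
/-mono-≤ m (suc n) p (suc q) h = *≤* (subst₂ ℤ._≤_ (ℤ.pos-* m (suc q)) (ℤ.pos-* p (suc n)) (ℤ.+≤+ h))

/-cancel-≤ : ∀ m n p q .{{_ : NonZero n}} .{{_ : NonZero q}} →
             + m / n ℚ.≤ + p / q → m * q ≤ p * n
/-cancel-≤ m (suc n) p (suc q) (*≤* h) =
  ℤ.drop‿+≤+ (subst₂ ℤ._≤_ (sym (ℤ.pos-* m (suc q))) (sym (ℤ.pos-* p (suc n))) h)

/-* : ∀ m n p q .{{_ : NonZero n}} .{{_ : NonZero q}} →
      (+ m / n) ℚ.* (+ p / q) ≡ (+ (m * p) / (n * q)) {{ℕ.m*n≢0 n q}}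
/-* m (suc n) p (suc q) = cong (λ i → mkℚᵘ i (q + n * suc q)) (sym (ℤ.pos-* m p))

/-^ : ∀ m n b .{{_ : NonZero n}} → (+ m / n) ^ℚ b ≡ (+ (m ^ b) / (n ^ b)) {{ℕ.m^n≢0 n b}}
/-^ m n zero    = refl
/-^ m n (suc b) = trans (cong ((+ m / n) ℚ.*_) (/-^ m n b))
  (/-* m n (m ^ b) (n ^ b) {{_}} {{ℕ.m^n≢0 n b}})

-- The product is the one in the definition of `[3^-_]^_≤_`. As a single fraction it turns the size
-- condition into an inequality of natural numbers.
scaled-power : ∀ X m n b .{{_ : NonZero n}} →
  (+ X / 1) ℚ.* (+ m / n) ^ℚ b ≡ (+ (X * m ^ b) / (1 * n ^ b)) {{ℕ.m*n≢0 1 (n ^ b) {{_}} {{ℕ.m^n≢0 n b}}}}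
scaled-power X m n b = trans (cong ((+ X / 1) ℚ.*_) (/-^ m n b))
  (/-* X 1 (m ^ b) (n ^ b) {{_}} {{ℕ.m^n≢0 n b}})

1≤scaled-power : ∀ X m n b .{{_ : NonZero n}} → n ^ b ≤ X * m ^ b → 1ℚᵘ ℚ.≤ (+ X / 1) ℚ.* (+ m / n) ^ℚ b
1≤scaled-power X m n b h = subst (1ℚᵘ ℚ.≤_) (sym (scaled-power X m n b))
  (/-mono-≤ 1 1 (X * m ^ b) (1 * n ^ b) {{_}} {{ℕ.m*n≢0 1 (n ^ b) {{_}} {{ℕ.m^n≢0 n b}}}}
    (subst₂ _≤_ (sym (trans (ℕ.*-identityˡ _) (ℕ.*-identityˡ _))) (sym (ℕ.*-identityʳ _)) h))

1≤scaled-power⁻¹ : ∀ X m n b .{{_ : NonZero n}} → 1ℚᵘ ℚ.≤ (+ X / 1) ℚ.* (+ m / n) ^ℚ b → n ^ b ≤ X * m ^ b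
1≤scaled-power⁻¹ X m n b h = subst₂ _≤_ (trans (ℕ.*-identityˡ _) (ℕ.*-identityˡ _)) (ℕ.*-identityʳ _)
  (/-cancel-≤ 1 1 (X * m ^ b) (1 * n ^ b) {{_}} {{ℕ.m*n≢0 1 (n ^ b) {{_}} {{ℕ.m^n≢0 n b}}}}
    (subst (1ℚᵘ ℚ.≤_) (scaled-power X m n b) h))

-- Extended reals

-- Roundedness supplies some `p′ < q` in the cut; if `q ≤ p` held, upward closure would put `p`
-- there too.
∉∈⇒< : ∀ (x : ℝ̅ ℓ) {p q} → ¬ (p ∈ above x) → q ∈ above x → p ℚ.< q
∉∈⇒< x {p} {q} p∉x q∈x with rounded x q∈x
... | p′ , p′<q , p′∈x = ℚ.≰⇒> λ q≤p → p∉x (upClosed x (ℚ.<-≤-trans p′<q q≤p) p′∈x)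

-- A cover of the larger set also covers the smaller one, at the same cost.
dimH-mono : ∀ {X : Pred ℤ₃ ℓ} {X′ : Pred ℤ₃ ℓ′} → X ⊆ X′ → dimH X ≤ᴿ dimH X′
dimH-mono X⊆X′ (s , 0≤s , null , s<q) = s , 0≤s
  , (λ m ε 0<ε → let U , r , cover , bound , sum = null m ε 0<ε in
       U , r , (λ x x∈X → cover x (X⊆X′ x∈X)) , bound , sum)
  , s<q

2ℚ : ℚᵘ
2ℚ = + 2 / 1

half-positive : ∀ {q} → half log₃2 <ℚ q → 0ℚᵘ ℚ.< q
half-positive {q} (0<2q , _) = ℚ.*-cancelˡ-<-nonNeg 2ℚ (ℚ.<-respˡ-≃ (ℚ.≃-sym (ℚ.*-zeroʳ 2ℚ)) 0<2q)

double-num : ∀ a b → ↥ (2ℚ ℚ.* mkℚᵘ (+ a) b) ≡ + (2 * a)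
double-num a b = sym (ℤ.pos-* 2 a)

double-den : ∀ a b → ↧ₙ (2ℚ ℚ.* mkℚᵘ (+ a) b) ≡ suc b
double-den a b = cong suc (ℕ.+-identityʳ b)

-- Unnormalised multiplication by 2 doubles the numerator and keeps the denominator, so the cut of
-- `log₃2` at the doubled fraction is this inequality.
half-log₃2⇒ : ∀ {a b} → half log₃2 <ℚ mkℚᵘ (+ a) b → 2 ^ suc b < 3 ^ (2 * a)
half-log₃2⇒ {a} {b} (_ , h) = subst₂ (λ d n → 2 ^ d < 3 ^ ∣ n ∣) (double-den a b) (double-num a b) h

half-log₃2⇐ : ∀ {a b} → 0ℚᵘ ℚ.< mkℚᵘ (+ a) b → 2 ^ suc b < 3 ^ (2 * a) → half log₃2 <ℚ mkℚᵘ (+ a) b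
half-log₃2⇐ {a} {b} 0<q h =
    ℚ.<-respˡ-≃ (ℚ.*-zeroʳ 2ℚ) (ℚ.*-monoʳ-<-pos 2ℚ 0<q)
  , subst₂ (λ d n → 2 ^ d < 3 ^ ∣ n ∣) (sym (double-den a b)) (sym (double-num a b)) h

-- 971/1539 and 665/1054 come from the continued fraction of log₃ 2; they are the
-- simplest fractions that separate log₃ 2 from 2 · 0.315464 and 2 · 0.315465.

3^971≤2^1539 : 3 ^ 971 ≤ 2 ^ 1539
3^971≤2^1539 = ℕ.≤ᵇ⇒≤ (3 ^ 971) (2 ^ 1539) tt

2^1054<3^665 : 2 ^ 1054 < 3 ^ 665
2^1054<3^665 = ℕ.<ᵇ⇒< (2 ^ 1054) (3 ^ 665) tt

half-log₃2-lower : fromℚ (+ 315464 / 1000000) ≤ᴿ half log₃2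
half-log₃2-lower {q} 2q∈ = ℚ.*-cancelˡ-<-nonNeg 2ℚ (ℚ.<-trans
  (toWitness {a? = 2ℚ ℚ.* (+ 315464 / 1000000) ℚ.<? + 971 / 1539} tt)
  (∉∈⇒< log₃2 {+ 971 / 1539} {2ℚ ℚ.* q} (λ (_ , h) → ℕ.<⇒≱ h 3^971≤2^1539) 2q∈))

-- Stated for a variable q, since the exponents 2 ^ 1000000 and 3 ^ 630930 must not be evaluated.
665/1054<2q⇒ : ∀ q → + 665 / 1054 ℚ.< 2ℚ ℚ.* q → half log₃2 <ℚ q
665/1054<2q⇒ q h = upClosed log₃2 {+ 665 / 1054} {2ℚ ℚ.* q} h
  (ℚ.positive⁻¹ (+ 665 / 1054) , 2^1054<3^665)

half-log₃2-upper : half log₃2 <ℚ (+ 315465 / 1000000)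
half-log₃2-upper = 665/1054<2q⇒ (+ 315465 / 1000000)
  (toWitness {a? = + 665 / 1054 ℚ.<? 2ℚ ℚ.* (+ 315465 / 1000000)} tt)

-- The covering of Y by cylinders

-- The first `K` even-place digits read in binary, lowest first: the index of the cylinder that
-- contains the point.
code : ℕ → Digits → ℕ
code zero    a = 0
code (suc K) a = toℕ (a 0) + code K (a ∘ suc ∘ suc) * 2

-- The number whose base 9 digits are the binary digits of i.
base2→9 : ℕ → ℕ → ℕ
base2→9 zero    i = 0
base2→9 (suc K) i = i ℕ.% 2 + 9 * base2→9 K (i ℕ./ 2)

toℕ-is01 : ∀ {d} → Is01 d → toℕ d < 2
toℕ-is01 (inj₁ refl) = s≤s z≤n
toℕ-is01 (inj₂ refl) = s≤s (s≤s z≤n)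

code<2^K : ∀ K {a} → (∀ k → Is01 (a (2 * k))) → code K a < 2 ^ K
code<2^K zero    even01 = s≤s z≤n
code<2^K (suc K) {a} even01 = begin-strict
  toℕ (a 0) + code K a″ * 2     <⟨ ℕ.+-monoˡ-< (code K a″ * 2) (toℕ-is01 (even01 0)) ⟩
  suc (code K a″) * 2           ≤⟨ ℕ.*-monoˡ-≤ 2 (code<2^K K (drop2-even {a} even01)) ⟩
  2 ^ K * 2                     ≡⟨ ℕ.*-comm (2 ^ K) 2 ⟩
  2 ^ suc K                     ∎
  where
  open ℕ.≤-Reasoning
  a″ : Digits
  a″ = a ∘ suc ∘ suc

d+c*2%2 : ∀ d c → d < 2 → (d + c * 2) ℕ.% 2 ≡ d
d+c*2%2 d c d<2 = trans (ℕ.[m+kn]%n≡m%n d c 2) (ℕ.m<n⇒m%n≡m d<2)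

d+c*2/2 : ∀ d c → d < 2 → (d + c * 2) ℕ./ 2 ≡ c
d+c*2/2 d c d<2 = trans (ℕ.+-distrib-/-∣ʳ d (ℕ∣.n∣m*n c))
  (cong₂ _+_ (ℕ.m<n⇒m/n≡0 d<2) (ℕ.m*n/n≡m c 2))

-- Two ternary digits form one base 9 digit, which is the even-place digit because the odd one
-- vanishes. Thus `base2→9` gives the centres of the cylinders.
digitSum≡base2→9 : ∀ K {a} → (∀ k → Is01 (a (2 * k))) → OddZero a →
                   digitSum a (2 * K) ≡ base2→9 K (code K a)
digitSum≡base2→9 zero    even01 odd0 = refl
digitSum≡base2→9 (suc K) {a} even01 odd0 = begin
  digitSum a (2 * suc K)                    ≡⟨ cong (digitSum a) (ℕ.*-suc 2 K) ⟩
  digitSum a (2 + 2 * K)                    ≡⟨ digitSum-front a (suc (2 * K)) ⟩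
  d + 3 * digitSum (a ∘ suc) (suc (2 * K))  ≡⟨ cong (λ s → d + 3 * s) (digitSum-front (a ∘ suc) (2 * K)) ⟩
  d + 3 * (toℕ (a 1) + 3 * digitSum a″ (2 * K))
    ≡⟨ cong₂ (λ e s → d + 3 * (toℕ e + 3 * s)) (odd0 0)
         (digitSum≡base2→9 K (drop2-even {a} even01) (drop2-odd {a} odd0)) ⟩
  d + 3 * (3 * base2→9 K c)                 ≡⟨ cong (λ e → d + e) (sym (ℕ.*-assoc 3 3 (base2→9 K c))) ⟩
  d + 9 * base2→9 K c                       ≡⟨ cong₂ (λ e i → e + 9 * base2→9 K i)
                                                 (sym (d+c*2%2 d c d<2)) (sym (d+c*2/2 d c d<2)) ⟩
  base2→9 (suc K) (d + c * 2)               ∎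
  where
  open ≡-Reasoning
  a″ : Digits
  a″ = a ∘ suc ∘ suc
  d c : ℕ
  d = toℕ (a 0)
  c = code K a″
  d<2 : d < 2
  d<2 = toℕ-is01 (even01 0)

-- Total size of the covering

/-+-1 : ∀ n R .{{_ : NonZero R}} → (+ n / R) ℚ.+ (+ 1 / R) ℚ.≃ + suc n / R
/-+-1 n (suc R) = *≡* (solve 2 (λ n r →
    (n :* r :+ con (+ 1) :* r) :* r := (con (+ 1) :+ n) :* (r :* r)) refl (+ n) (+ suc R))
  where open ℤ-Solver

∑<-≤n/R : ∀ R .{{_ : NonZero R}} {f} → (∀ i → f i ℚ.≤ + 1 / R) → ∀ n → ∑< n f ℚ.≤ + n / R
∑<-≤n/R R f≤ zero    = /-mono-≤ 0 1 0 R z≤n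
∑<-≤n/R R f≤ (suc n) = ℚ.≤-respʳ-≃ (/-+-1 n R) (ℚ.+-mono-≤ (∑<-≤n/R R f≤ n) (f≤ n))

∑<-truncate : ∀ C {f} → (∀ i → C ≤ i → f i ≡ 0ℚᵘ) → ∀ k → ∑< (k + C) f ℚ.≃ ∑< C f
∑<-truncate C f≡0 zero    = ℚ.≃-refl
∑<-truncate C {f} f≡0 (suc k) = ℚ.≃-trans
  (ℚ.+-cong (∑<-truncate C f≡0 k) (ℚ.≃-reflexive (f≡0 (k + C) (ℕ.m≤n+m C k))))
  (ℚ.+-identityʳ (∑< C f))

∑<-≤C/R : ∀ C R .{{_ : NonZero R}} {f} → (∀ i → f i ℚ.≤ + 1 / R) →
          (∀ i → C ≤ i → f i ≡ 0ℚᵘ) → ∀ n → ∑< n f ℚ.≤ + C / R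
∑<-≤C/R C R {f} f≤ f≡0 n with n ℕ.≤? C
... | yes n≤C = ℚ.≤-trans (∑<-≤n/R R f≤ n) (/-mono-≤ n R C R (ℕ.*-monoˡ-≤ R n≤C))
... | no  n≰C = ℚ.≤-trans
  (ℚ.≤-reflexive (subst (λ l → ∑< l f ℚ.≃ ∑< C f) (ℕ.m∸n+n≡m (ℕ.≰⇒≥ n≰C)) (∑<-truncate C f≡0 (n ∸ C))))
  (∑<-≤n/R R f≤ C)

-- Bernoulli's inequality `1 + t / B ≤ (1 + 1 / B) ^ t`, cleared of denominators.
bernoulli : ∀ B t → B ^ t * (B + t) ≤ B * suc B ^ t
bernoulli B zero    = ℕ.≤-reflexive (solve 1 (λ B → con 1 :* (B :+ con 0) := B :* con 1) refl B)
  where open +-*-Solver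
bernoulli B (suc t) = begin
  B * P * (B + suc t)                      ≤⟨ ℕ.m≤m+n _ (P * t) ⟩
  B * P * (B + suc t) + P * t              ≡⟨ solve 3 (λ B P t →
      B :* P :* (B :+ (con 1 :+ t)) :+ P :* t := (con 1 :+ B) :* (P :* (B :+ t))) refl B P t ⟩
  suc B * (P * (B + t))                    ≤⟨ ℕ.*-monoʳ-≤ (suc B) (bernoulli B t) ⟩
  suc B * (B * suc B ^ t)                  ≡⟨ solve 2 (λ B Q →
      (con 1 :+ B) :* (B :* Q) := B :* ((con 1 :+ B) :* Q)) refl B (suc B ^ t) ⟩
  B * suc B ^ suc t                        ∎
  where
  open ℕ.≤-Reasoning
  open +-*-Solver
  P : ℕ
  P = B ^ t

-- Since `A` is at least `B + 1`, Bernoulli at the exponent `B * c` makes the ratio of the powers at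
-- least `1 + c`.
power-gap : ∀ {A} B c .{{_ : NonZero B}} → B < A → B ^ (B * c) * c ≤ A ^ (B * c)
power-gap {A} B c B<A = ℕ.*-cancelˡ-≤ B (begin
  B * (P * c)          ≡⟨ solve 3 (λ B P c → B :* (P :* c) := P :* (B :* c)) refl B P c ⟩
  P * (B * c)          ≤⟨ ℕ.*-monoʳ-≤ P (ℕ.m≤n+m (B * c) B) ⟩
  P * (B + B * c)      ≤⟨ bernoulli B (B * c) ⟩
  B * suc B ^ (B * c)  ≤⟨ ℕ.*-monoʳ-≤ B (ℕ.^-monoˡ-≤ (B * c) B<A) ⟩
  B * A ^ (B * c)      ∎)
  where
  open ℕ.≤-Reasoning
  open +-*-Solver
  P : ℕ
  P = B ^ (B * c)

-- The factor `suc b` in the scale cancels the denominator of the exponent: the power is exactly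
-- `3 ^ (2 * a * t)` inverted. Larger exponents `q` only decrease it.
[3^-]^-bound : ∀ a b t R .{{_ : NonZero R}} → R ≡ 3 ^ (2 * a * t) →
               [3^- 2 * (suc b * t) ]^ fromℚ (mkℚᵘ (+ a) b) ≤ (+ 1 / R)
[3^-]^-bound a b t R R≡ = /-mono-≤ 0 1 1 R z≤n , below
  where
  n : ℕ
  n = 2 * (suc b * t)
  below : ∀ q → mkℚᵘ (+ a) b ℚ.< q →
          1ℚᵘ ℚ.≤ (+ (3 ^ (n * ∣ ↥ q ∣)) / 1) ℚ.* (+ 1 / R) ^ℚ (↧ₙ q)
  below (mkℚᵘ (ℤ.-[1+ _ ]) _) p<q with ℚ.≤-<-trans (/-mono-≤ 0 1 a (suc b) z≤n) p<q
  ... | *<* ()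
  below (mkℚᵘ (+ c) d) (*<* p<q) = 1≤scaled-power (3 ^ (n * c)) 1 R (suc d) (begin
    R ^ suc d                       ≡⟨ cong (_^ suc d) R≡ ⟩
    (3 ^ (2 * a * t)) ^ suc d       ≡⟨ ℕ.^-*-assoc 3 (2 * a * t) (suc d) ⟩
    3 ^ (2 * a * t * suc d)         ≤⟨ ℕ.^-monoʳ-≤ 3 exponents ⟩
    3 ^ (n * c)                     ≡⟨ sym (ℕ.*-identityʳ _) ⟩
    3 ^ (n * c) * 1                 ≡⟨ cong (3 ^ (n * c) *_) (sym (ℕ.^-zeroˡ (suc d))) ⟩
    3 ^ (n * c) * 1 ^ suc d         ∎)
    where
    open ℕ.≤-Reasoning
    open +-*-Solver
    ad≤cb : a * suc d ≤ c * suc b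
    ad≤cb = ℕ.<⇒≤ (ℤ.drop‿+<+ (subst₂ ℤ._<_ (sym (ℤ.pos-* a (suc d))) (sym (ℤ.pos-* c (suc b))) p<q))
    exponents : 2 * a * t * suc d ≤ n * c
    exponents = begin
      2 * a * t * suc d       ≡⟨ solve 3 (λ a t d → con 2 :* a :* t :* d := con 2 :* t :* (a :* d)) refl a t (suc d) ⟩
      2 * t * (a * suc d)     ≤⟨ ℕ.*-monoʳ-≤ (2 * t) ad≤cb ⟩
      2 * t * (c * suc b)     ≡⟨ solve 3 (λ c t b → con 2 :* t :* (c :* b) := con 2 :* (b :* t) :* c) refl c t (suc b) ⟩
      n * c                   ∎

infix 5 _when_

_when_ : ∀ {P : Set} → ℚᵘ → Dec P → ℚᵘ
ρ when yes _ = ρ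
ρ when no  _ = 0ℚᵘ

when-≤ : ∀ {P : Set} {ρ} → 0ℚᵘ ℚ.≤ ρ → (P? : Dec P) → ρ when P? ℚ.≤ ρ
when-≤ 0≤ρ (yes _) = ℚ.≤-refl
when-≤ 0≤ρ (no  _) = 0≤ρ

when-no : ∀ {P : Set} {ρ} → ¬ P → (P? : Dec P) → ρ when P? ≡ 0ℚᵘ
when-no ¬p (yes p) = contradiction p ¬p
when-no ¬p (no  _) = refl

ℋ-Y≡0 : ∀ a b → 2 ^ suc b < 3 ^ (2 * a) → ℋ[ fromℚ (mkℚᵘ (+ a) b) ] Y ≡0
ℋ-Y≡0 a b B<A m ε 0<ε = U , r , cover , bound , total ε 0<ε f≤
  where
  B f t K n C R : ℕ
  B = 2 ^ suc b
  f = ↧ₙ ε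
  -- The factor `B` is the one that `power-gap` asks for. It yields `C * f ≤ R`, so the total
  -- `C / R` is at most `1 / f`, hence at most `ε`; the summand `m` makes the diameters small
  -- enough.
  t = B * (f + m)
  K = suc b * t
  n = 2 * K
  C = 2 ^ K
  R = 3 ^ (2 * a * t)
  instance
    B≢0 : NonZero B
    B≢0 = ℕ.m^n≢0 2 (suc b)
    R≢0 : NonZero R
    R≢0 = ℕ.m^n≢0 3 (2 * a * t)

  U : ℕ → Pred ℤ₃ _
  -- The clause `i < C` empties the sets from index `C` on, which may then be charged 0.
  U i x = i < C × + (3 ^ n) ∣ residue x n ℤ.- + base2→9 K i

  r : ℕ → ℚᵘ
  r i = + 1 / R when (i ℕ.<? C)

  cover : ∀ x → x ∈ Y → ∃[ i ] x ∈ U i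
  cover x (a , even01 , odd0 , x≈a) = code K a , code<2^K K even01 ,
    subst (λ s → + (3 ^ n) ∣ residue x n ℤ.- + s) (digitSum≡base2→9 K even01 odd0) (x≈a n)

  m≤n : m ≤ n
  m≤n = begin
    m                ≤⟨ ℕ.m≤n+m m f ⟩
    f + m            ≤⟨ ℕ.m≤n*m (f + m) B ⟩
    t                ≤⟨ ℕ.m≤n*m t (suc b) ⟩
    K                ≤⟨ ℕ.m≤n*m K 2 ⟩
    n                ∎
    where open ℕ.≤-Reasoning

  bound : ∀ i → (Empty (U i) × 0ℚᵘ ℚ.≤ r i) ⊎
                (∃[ l ] m ≤ l × Diam (U i) ≤3^- l × [3^- l ]^ fromℚ (mkℚᵘ (+ a) b) ≤ r i)
  bound i = case (i ℕ.<? C)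
    where
    case : (i<?C : Dec (i < C)) → (Empty (U i) × 0ℚᵘ ℚ.≤ + 1 / R when i<?C) ⊎
      (∃[ l ] m ≤ l × Diam (U i) ≤3^- l × [3^- l ]^ fromℚ (mkℚᵘ (+ a) b) ≤ (+ 1 / R when i<?C))
    case (no  i≮C) = inj₁ ((λ x (i<C , _) → i≮C i<C) , ℚ.≤-refl)
    case (yes i<C) = inj₂ (n , m≤n
      , (λ x y (_ , x∈) (_ , y∈) →
           ∣-minus-trans (residue x n) _ (residue y n) x∈ (∣-minus-sym (residue y n) _ y∈))
      , [3^-]^-bound a b t R refl)

  r≤ : ∀ i → r i ℚ.≤ + 1 / R
  r≤ i = when-≤ (/-mono-≤ 0 1 1 R z≤n) (i ℕ.<? C)

  r≡0 : ∀ i → C ≤ i → r i ≡ 0ℚᵘ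
  r≡0 i C≤i = when-no (ℕ.≤⇒≯ C≤i) (i ℕ.<? C)

  f≤ : C * f ≤ R
  f≤ = begin
    C * f                          ≤⟨ ℕ.*-monoʳ-≤ C (ℕ.m≤m+n f m) ⟩
    C * (f + m)                    ≡⟨ cong (_* (f + m)) (sym (ℕ.^-*-assoc 2 (suc b) t)) ⟩
    B ^ t * (f + m)                ≤⟨ power-gap B (f + m) B<A ⟩
    (3 ^ (2 * a)) ^ t              ≡⟨ ℕ.^-*-assoc 3 (2 * a) t ⟩
    R                              ∎
    where open ℕ.≤-Reasoning

  total : ∀ ε → 0ℚᵘ ℚ.< ε → C * ↧ₙ ε ≤ R → ∀ M → ∑< M r ℚ.≤ ε
  total (mkℚᵘ (ℤ.-[1+ _ ]) _) (*<* ()) _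
  total (mkℚᵘ (+ 0) _) (*<* (ℤ.+<+ ())) _
  total (mkℚᵘ +[1+ e ] d) _ C*d≤R M = ℚ.≤-trans (∑<-≤C/R C R r≤ r≡0 M)
    (/-mono-≤ C R (suc e) (suc d) (ℕ.≤-trans C*d≤R (ℕ.m≤n*m R (suc e))))

dimH-Y≤half-log₃2 : dimH Y ≤ᴿ half log₃2
dimH-Y≤half-log₃2 {q} 2q∈ with rounded (half log₃2) {q} 2q∈
-- The exponent witnessing `dimH Y < q` has to lie strictly below `q`, so a rational between
-- `half log₃2` and `q` is taken.
... | p , p<q , 2p∈ = fromℚ p , (λ {r} → ℚ.<-trans 0<p) , null p 2p∈ 0<p , p<q
  where
  0<p : 0ℚᵘ ℚ.< p
  0<p = half-positive {p} 2p∈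
  null : ∀ p → half log₃2 <ℚ p → 0ℚᵘ ℚ.< p → ℋ[ fromℚ p ] Y ≡0
  null (mkℚᵘ (ℤ.-[1+ _ ]) _) _ (*<* ())
  null (mkℚᵘ (+ a) b) 2p∈ _ = ℋ-Y≡0 a b (half-log₃2⇒ {a} {b} 2p∈)

-- Points of Y as bit sequences

bit : Bool → Fin 3
bit false = 0F
bit true  = 1F

bit-is01 : ∀ d → Is01 (bit d)
bit-is01 false = inj₁ refl
bit-is01 true  = inj₂ refl

toℕ-bit-injective : ∀ {d e} → toℕ (bit d) ≡ toℕ (bit e) → d ≡ e
toℕ-bit-injective {false} {false} _ = refl
toℕ-bit-injective {true}  {true}  _ = refl

spread : (ℕ → Bool) → Digits
spread β zero          = bit (β 0)
spread β (suc zero)    = 0F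
spread β (suc (suc j)) = spread (β ∘ suc) j

spread-even : ∀ β k → spread β (2 * k) ≡ bit (β k)
spread-even β zero    = refl
spread-even β (suc k) = trans (cong (spread β) (ℕ.*-suc 2 k)) (spread-even (β ∘ suc) k)

spread-odd : ∀ β → OddZero (spread β)
spread-odd β zero    = refl
spread-odd β (suc k) = trans (cong (λ j → spread β (j + 1)) (ℕ.*-suc 2 k)) (spread-odd (β ∘ suc) k)

spread∈Y : ∀ β → Σ3^ (spread β) ∈ Y
spread∈Y β = spread β , (λ k → subst Is01 (sym (spread-even β k)) (bit-is01 (β k)))
  , spread-odd β , λ n → Σ3^-cong {spread β} (λ _ → refl) n

prefix : ℕ → (ℕ → Bool) → List Bool
prefix zero    β = []
prefix (suc L) β = β 0 ∷ prefix L (β ∘ suc)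

digitSum<3^n : ∀ a n → digitSum a n < 3 ^ n
digitSum<3^n a zero    = s≤s z≤n
digitSum<3^n a (suc n) = begin-strict
  digitSum a n + toℕ (a n) * p     <⟨ ℕ.+-mono-<-≤ (digitSum<3^n a n) (ℕ.*-monoˡ-≤ p (ℕ.≤-pred (Fin.toℕ<n (a n)))) ⟩
  p + 2 * p                        ∎
  where
  open ℕ.≤-Reasoning
  p : ℕ
  p = 3 ^ n

-- If `i` exceeded `j`, then `i ∸ j` would be a positive multiple of `p` smaller than `p`.
∣-minus⇒≤ : ∀ {p i j} → i < p → + p ∣ + i ℤ.- + j → i ≤ j
∣-minus⇒≤ {p} {i} {j} i<p p∣i-j with i ℕ.≤? j
... | yes i≤j = i≤j
... | no  i≰j = contradiction (ℕ∣.∣⇒≤ {{>-nonZero (ℕ.m<n⇒0<n∸m (ℕ.≰⇒> i≰j))}} (∣.∣⇒∣ᵤ p∣i∸j))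
                  (ℕ.<⇒≱ (ℕ.≤-<-trans (ℕ.m∸n≤m i j) i<p))
  where
  p∣i∸j : + p ∣ + (i ∸ j)
  p∣i∸j = subst (+ p ∣_) (trans (ℤ.[+m]-[+n]≡m⊖n i j) (ℤ.⊖-≥ (ℕ.≰⇒≥ i≰j))) p∣i-j

remainder-quotient-unique : ∀ n .{{_ : NonZero n}} {d e x y} → d < n → e < n →
                            d + n * x ≡ e + n * y → d ≡ e × x ≡ y
remainder-quotient-unique n {d} {e} {x} {y} d<n e<n eq = d≡e ,
  ℕ.*-cancelˡ-≡ x y n (ℕ.+-cancelˡ-≡ d _ _ (trans eq (cong (_+ n * y) (sym d≡e))))
  where
  reduce : ∀ d x → d < n → (d + n * x) ℕ.% n ≡ d
  reduce d x d<n = trans (cong (λ z → (d + z) ℕ.% n) (ℕ.*-comm n x))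
    (trans (ℕ.[m+kn]%n≡m%n d x n) (ℕ.m<n⇒m%n≡m d<n))
  d≡e : d ≡ e
  d≡e = trans (sym (reduce d x d<n)) (trans (cong (ℕ._% n) eq) (reduce e y e<n))

digitSum-injective : ∀ a b n → digitSum a (suc n) ≡ digitSum b (suc n) →
                     toℕ (a 0) ≡ toℕ (b 0) × digitSum (a ∘ suc) n ≡ digitSum (b ∘ suc) n
digitSum-injective a b n eq = remainder-quotient-unique 3 (Fin.toℕ<n (a 0)) (Fin.toℕ<n (b 0))
  (trans (sym (digitSum-front a n)) (trans eq (digitSum-front b n)))

-- Of the places below `n`, exactly `⌈ n /2⌉` are even, and these hold the bits; for odd `n` the
-- last place still holds one.
digitSum⇒prefix : ∀ n β γ → digitSum (spread β) n ≡ digitSum (spread γ) n →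
                  prefix ⌈ n /2⌉ β ≡ prefix ⌈ n /2⌉ γ
digitSum⇒prefix zero          β γ eq = refl
digitSum⇒prefix (suc zero)    β γ eq = cong (_∷ [])
  (toℕ-bit-injective (proj₁ (digitSum-injective (spread β) (spread γ) 0 eq)))
digitSum⇒prefix (suc (suc n)) β γ eq
  with digitSum-injective (spread β) (spread γ) (suc n) eq
... | eq₀ , eq₁ = cong₂ _∷_ (toℕ-bit-injective eq₀) (digitSum⇒prefix n (β ∘ suc) (γ ∘ suc)
  (proj₂ (digitSum-injective (spread β ∘ suc) (spread γ ∘ suc) n eq₁)))

-- Both digit sums lie below `3 ^ n`, so their congruence is an equality.
close⇒prefix : ∀ n β γ → ∣ Σ3^ (spread β) - Σ3^ (spread γ) ∣₃≤3^- n →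
               prefix ⌈ n /2⌉ β ≡ prefix ⌈ n /2⌉ γ
close⇒prefix n β γ close = digitSum⇒prefix n β γ (ℕ.≤-antisym
  (∣-minus⇒≤ (digitSum<3^n (spread β) n) close)
  (∣-minus⇒≤ (digitSum<3^n (spread γ) n) (∣-minus-sym (+ digitSum (spread β) n) (+ digitSum (spread γ) n) close)))

-- Escaping from cylinders of small total weight

-- `nothing` is the empty set and `just c` the set of bit sequences that begin with `c`; `weight` is
-- the fair coin measure.
Cylinder : Set
Cylinder = Maybe (List Bool)

weight : Cylinder → ℚᵘ
weight nothing        = 0ℚᵘ
weight (just [])      = 1ℚᵘ
weight (just (_ ∷ c)) = ½ ℚ.* weight (just c)

-- The part of a cylinder that lies behind a first bit, as a cylinder in the remaining bits.
cut : Bool → Cylinder → Cylinder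
cut d     nothing            = nothing
cut d     (just [])          = just []
cut false (just (false ∷ c)) = just c
cut false (just (true  ∷ c)) = nothing
cut true  (just (false ∷ c)) = nothing
cut true  (just (true  ∷ c)) = just c

cut-∷ : ∀ d c → cut d (just (d ∷ c)) ≡ just c
cut-∷ false c = refl
cut-∷ true  c = refl

weight-nonNeg : ∀ x → 0ℚᵘ ℚ.≤ weight x
weight-nonNeg nothing        = ℚ.≤-refl
weight-nonNeg (just [])      = ℚ.nonNegative⁻¹ 1ℚᵘ
weight-nonNeg (just (_ ∷ c)) = ℚ.≤-respˡ-≃ (ℚ.*-zeroʳ ½) (ℚ.*-monoʳ-≤-nonNeg ½ (weight-nonNeg (just c)))

2*½ : ∀ w → w ℚ.≃ 2ℚ ℚ.* (½ ℚ.* w)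
2*½ w = ℚ.≃-sym (ℚ.≃-trans (ℚ.≃-sym (ℚ.*-assoc 2ℚ ½ w))
  (ℚ.≃-trans (ℚ.*-congʳ {w} {2ℚ ℚ.* ½} {1ℚᵘ} (*≡* refl)) (ℚ.*-identityˡ w)))

-- The measure of a set is the average of its conditional measures given the first bit.
weight-cut : ∀ x → weight (cut false x) ℚ.+ weight (cut true x) ℚ.≃ 2ℚ ℚ.* weight x
weight-cut nothing            = *≡* refl
weight-cut (just [])          = *≡* refl
weight-cut (just (false ∷ c)) = ℚ.≃-trans (ℚ.+-identityʳ _) (2*½ (weight (just c)))
weight-cut (just (true  ∷ c)) = ℚ.≃-trans (ℚ.+-identityˡ _) (2*½ (weight (just c)))

∑<-mono-≤ : ∀ n {f g} → (∀ i → f i ℚ.≤ g i) → ∑< n f ℚ.≤ ∑< n g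
∑<-mono-≤ zero    f≤g = ℚ.≤-refl
∑<-mono-≤ (suc n) f≤g = ℚ.+-mono-≤ (∑<-mono-≤ n f≤g) (f≤g n)

∑<-extend : ∀ {f} → (∀ i → 0ℚᵘ ℚ.≤ f i) → ∀ k n → ∑< n f ℚ.≤ ∑< (k + n) f
∑<-extend     0≤f zero    n = ℚ.≤-refl
∑<-extend {f} 0≤f (suc k) n = ℚ.≤-trans (∑<-extend 0≤f k n)
  (ℚ.p≤p+q (∑< (k + n) f) (f (k + n)) {{ℚ.nonNegative (0≤f (k + n))}})

term≤∑< : ∀ {f} → (∀ i → 0ℚᵘ ℚ.≤ f i) → ∀ i → f i ℚ.≤ ∑< (suc i) f
term≤∑< {f} 0≤f i = ℚ.≤-trans (ℚ.≤-reflexive (ℚ.≃-sym (ℚ.+-identityˡ (f i))))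
  (ℚ.+-monoˡ-≤ (f i) (∑≥0 i))
  where
  ∑≥0 : ∀ n → 0ℚᵘ ℚ.≤ ∑< n f
  ∑≥0 n = subst (λ l → 0ℚᵘ ℚ.≤ ∑< l f) (ℕ.+-identityʳ n) (∑<-extend 0≤f n 0)

∑<-double : ∀ n {f g h} → (∀ i → f i ℚ.+ g i ℚ.≃ 2ℚ ℚ.* h i) → ∑< n f ℚ.+ ∑< n g ℚ.≃ 2ℚ ℚ.* ∑< n h
∑<-double zero    _  = *≡* refl
∑<-double (suc n) {f} {g} {h} eq = ℚ.≃-trans
  (interchange (CommutativeMonoid.commutativeSemigroup ℚ.+-0-commutativeMonoid) (∑< n f) (f n) (∑< n g) (g n))
  (ℚ.≃-trans (ℚ.+-cong (∑<-double n {f} {g} {h} eq) (eq n))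
    (ℚ.≃-sym (ℚ.*-distribˡ-+ 2ℚ (∑< n h) (h n))))

Light : (ℕ → Cylinder) → Set
Light F = ∀ n → ∑< n (weight ∘ F) ℚ.≤ ½

half-light : ∀ {u v w} → u ℚ.+ v ℚ.≃ 2ℚ ℚ.* w → w ℚ.≤ ½ → ½ ℚ.< v → u ℚ.≤ ½
half-light {u} {v} {w} eq w≤½ ½<v = ℚ.≮⇒≥ λ ½<u → ℚ.<-irrefl-≡ refl (ℚ.<-≤-trans
  (ℚ.+-mono-< ½<u ½<v)
  (ℚ.≤-trans (ℚ.≤-reflexive eq) (ℚ.≤-trans (ℚ.*-monoʳ-≤-nonNeg 2ℚ w≤½) (ℚ.≤-reflexive (*≡* refl)))))

module _ (em : ExcludedMiddle 0ℓ) where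

  -- The two relative masses average to at most `½`, so they cannot both exceed `½`. Lightness
  -- speaks of all partial sums, hence excluded middle to decide it.
  light-branch : ∀ F → Light F → ∃[ d ] Light (cut d ∘ F)
  light-branch F light with em {Light (cut false ∘ F)}
  ... | yes light₀  = false , light₀
  ... | no  ¬light₀ = true , λ n → ℚ.≮⇒≥ λ ½<true → ¬light₀ λ l →
    -- A heavy partial sum of length `n` in the true branch is compared with any length `l` in the
    -- false branch at the common length `M`. So the false branch would be light after all.
    let M = n + l in
    ℚ.≤-trans (∑<-extend (weight-nonNeg ∘ cut false ∘ F) n l)
      (half-light (∑<-double M (weight-cut ∘ F)) (light M)
        (ℚ.<-≤-trans ½<true (subst (λ m → ∑< n (weight ∘ cut true ∘ F) ℚ.≤ ∑< m (weight ∘ cut true ∘ F))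
          (ℕ.+-comm l n) (∑<-extend (weight-nonNeg ∘ cut true ∘ F) l n))))

  escape : ∀ F → Light F → ℕ → Bool
  escape F light zero    = proj₁ (light-branch F light)
  escape F light (suc k) = let d , light′ = light-branch F light in escape (cut d ∘ F) light′ k

  -- Cutting along the chosen bits would reduce such a cylinder to `just []`, whose weight 1 alone
  -- breaks lightness.
  escape-avoids : ∀ L F (light : Light F) i → ¬ (F i ≡ just (prefix L (escape F light)))
  escape-avoids zero    F light i eq = ℚ.<⇒≱ ½<1 (ℚ.≤-trans
    (subst (λ x → weight x ℚ.≤ ∑< (suc i) (weight ∘ F)) eq (term≤∑< (weight-nonNeg ∘ F) i))
    (light (suc i)))
    where
    ½<1 : ½ ℚ.< 1ℚᵘ
    ½<1 = *<* (ℤ.+<+ (s≤s (s≤s z≤n)))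
  escape-avoids (suc L) F light i eq =
    let d , light′ = light-branch F light in
    escape-avoids L (cut d ∘ F) light′ i
      (trans (cong (cut d) eq) (cut-∷ d (prefix L (escape (cut d ∘ F) light′))))

-- The lower bound for the dimension

weight-prefix : ∀ L β → weight (just (prefix L β)) ≡ (+ 1 / 2 ^ L) {{ℕ.m^n≢0 2 L}}
weight-prefix zero    β = refl
weight-prefix (suc L) β = trans (cong (½ ℚ.*_) (weight-prefix L (β ∘ suc)))
  (/-* 1 2 1 (2 ^ L) {{_}} {{ℕ.m^n≢0 2 L}})

*-^ : ∀ m n o → (m * n) ^ o ≡ m ^ o * n ^ o
*-^ m n zero    = refl
*-^ m n (suc o) = trans (cong (m * n *_) (*-^ m n o))
  (interchange ℕ.*-commutativeSemigroup m n (m ^ o) (n ^ o))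

^-cancelˡ-≤ : ∀ o .{{_ : NonZero o}} {m n} → m ^ o ≤ n ^ o → m ≤ n
^-cancelˡ-≤ o h = ℕ.≮⇒≥ λ n<m → ℕ.<⇒≱ (ℕ.^-monoˡ-< o n<m) h

n≤2⌈n/2⌉ : ∀ n → n ≤ 2 * ⌈ n /2⌉
n≤2⌈n/2⌉ n = begin
  n                       ≡⟨ sym (ℕ.⌊n/2⌋+⌈n/2⌉≡n n) ⟩
  ⌊ n /2⌋ + ⌈ n /2⌉       ≤⟨ ℕ.+-monoˡ-≤ ⌈ n /2⌉ (ℕ.⌊n/2⌋≤⌈n/2⌉ n) ⟩
  ⌈ n /2⌉ + ⌈ n /2⌉       ≡⟨ cong (λ k → ⌈ n /2⌉ + k) (sym (ℕ.+-identityʳ _)) ⟩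
  2 * ⌈ n /2⌉             ∎
  where open ℕ.≤-Reasoning

-- For `r = u / v` this bounds the mass of a cylinder by `r`. Squaring creates the exponent `2 * a`,
-- where the hypothesis replaces 3 by 2; then a root of order `2 * suc b` is taken.
mass-bound : ∀ a b n u v → 3 ^ (2 * a) ≤ 2 ^ suc b → v ^ suc b ≤ 3 ^ (n * a) * u ^ suc b →
             v ≤ u * 2 ^ ⌈ n /2⌉
mass-bound a b′ n u v 3≤2 h = ^-cancelˡ-≤ (b * 2) (begin
  v ^ (b * 2)                         ≡⟨ sym (ℕ.^-*-assoc v b 2) ⟩
  (v ^ b) ^ 2                         ≤⟨ ℕ.^-monoˡ-≤ 2 h ⟩
  (3 ^ (n * a) * u ^ b) ^ 2           ≡⟨ *-^ (3 ^ (n * a)) (u ^ b) 2 ⟩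
  (3 ^ (n * a)) ^ 2 * (u ^ b) ^ 2     ≡⟨ cong₂ _*_ (ℕ.^-*-assoc 3 (n * a) 2) (ℕ.^-*-assoc u b 2) ⟩
  3 ^ (n * a * 2) * u ^ (b * 2)       ≤⟨ ℕ.*-monoˡ-≤ (u ^ (b * 2)) powers ⟩
  (2 ^ L) ^ (b * 2) * u ^ (b * 2)     ≡⟨ ℕ.*-comm _ (u ^ (b * 2)) ⟩
  u ^ (b * 2) * (2 ^ L) ^ (b * 2)     ≡⟨ sym (*-^ u (2 ^ L) (b * 2)) ⟩
  (u * 2 ^ L) ^ (b * 2)               ∎)
  where
  open ℕ.≤-Reasoning
  b L : ℕ
  b = suc b′
  L = ⌈ n /2⌉
  powers : 3 ^ (n * a * 2) ≤ (2 ^ L) ^ (b * 2)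
  powers = begin
    3 ^ (n * a * 2)         ≡⟨ cong (3 ^_) (solve 2 (λ n a → n :* a :* con 2 := con 2 :* a :* n) refl n a) ⟩
    3 ^ (2 * a * n)         ≡⟨ sym (ℕ.^-*-assoc 3 (2 * a) n) ⟩
    (3 ^ (2 * a)) ^ n       ≤⟨ ℕ.^-monoˡ-≤ n 3≤2 ⟩
    (2 ^ b) ^ n             ≡⟨ ℕ.^-*-assoc 2 b n ⟩
    2 ^ (b * n)             ≤⟨ ℕ.^-monoʳ-≤ 2 (ℕ.*-monoʳ-≤ b (n≤2⌈n/2⌉ n)) ⟩
    2 ^ (b * (2 * L))       ≡⟨ cong (2 ^_) (solve 2 (λ b L → b :* (con 2 :* L) := L :* (b :* con 2)) refl b L) ⟩
    2 ^ (L * (b * 2))       ≡⟨ sym (ℕ.^-*-assoc 2 L (b * 2)) ⟩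
    (2 ^ L) ^ (b * 2)       ∎
    where open +-*-Solver

-- The size condition holds at every rational exponent above `s`. It is used at the given one, which
-- is at most half of `log₃2`.
weight≤r : ∀ {s : ℝ̅ 0ℓ} {a b} → s <ℚ mkℚᵘ (+ a) b → 3 ^ (2 * a) ≤ 2 ^ suc b →
           ∀ n r β → [3^- n ]^ s ≤ r → weight (just (prefix ⌈ n /2⌉ β)) ℚ.≤ r
weight≤r s<q 3≤2 n (mkℚᵘ (ℤ.-[1+ _ ]) _) β (*≤* () , _)
weight≤r {a = a} {b} s<q 3≤2 n (mkℚᵘ (+ u) v) β (_ , h) =
  subst (ℚ._≤ mkℚᵘ (+ u) v) (sym (weight-prefix L β))
    (/-mono-≤ 1 (2 ^ L) u (suc v) {{ℕ.m^n≢0 2 L}} (subst (_≤ u * 2 ^ L) (sym (ℕ.*-identityˡ (suc v)))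
      (mass-bound a b n u (suc v) 3≤2
        (1≤scaled-power⁻¹ (3 ^ (n * a)) u (suc v) (suc b) (h (mkℚᵘ (+ a) b) s<q)))))
  where
  L : ℕ
  L = ⌈ n /2⌉

module _ (em : ExcludedMiddle 0ℓ) where

  ℋ-Y≢0 : ∀ {s : ℝ̅ 0ℓ} {a b} → s <ℚ mkℚᵘ (+ a) b → 3 ^ (2 * a) ≤ 2 ^ suc b → ¬ (ℋ[ s ] Y ≡0)
  -- The tolerance `½` is the threshold of `Light`, and `m = 0` admits every diameter up to 1.
  ℋ-Y≢0 {s} s<q 3≤2 null with null 0 ½ (ℚ.positive⁻¹ ½)
  ... | U , r , cover , bound , sum≤½ = contradiction U∋x (uncovered (proj₁ (cover x x∈Y)))
    where
    -- Each covering set is replaced by a cylinder containing all bit sequences whose points it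
    -- meets, at no greater cost. Excluded middle decides whether there is such a sequence to anchor
    -- the cylinder.
    hull : ∀ i → Σ[ c ∈ Cylinder ] weight c ℚ.≤ r i ×
                 (∀ β → Σ3^ (spread β) ∈ U i → ∃[ L ] c ≡ just (prefix L β))
    hull i with em {∃[ β ] Σ3^ (spread β) ∈ U i} | bound i
    ... | no  miss    | inj₁ (_ , 0≤r) = nothing , 0≤r , λ β β∈U → contradiction (β , β∈U) miss
    ... | no  miss    | inj₂ (_ , _ , _ , 0≤r , _) = nothing , 0≤r , λ β β∈U → contradiction (β , β∈U) miss
    ... | yes (β , β∈U) | inj₁ (empty , _) = contradiction β∈U (empty _)
    ... | yes (β , β∈U) | inj₂ (n , _ , diam , size) =
      just (prefix ⌈ n /2⌉ β) , weight≤r {s} s<q 3≤2 n (r i) β size ,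
      λ γ γ∈U → ⌈ n /2⌉ , cong just (close⇒prefix n β γ (diam _ _ β∈U γ∈U))

    hulls : ℕ → Cylinder
    hulls i = proj₁ (hull i)

    light : Light hulls
    light n = ℚ.≤-trans (∑<-mono-≤ n (proj₁ ∘ proj₂ ∘ hull)) (sum≤½ n)

    x : ℤ₃
    x = Σ3^ (spread (escape em hulls light))

    x∈Y : x ∈ Y
    x∈Y = spread∈Y (escape em hulls light)

    U∋x : x ∈ U (proj₁ (cover x x∈Y))
    U∋x = proj₂ (cover x x∈Y)

    uncovered : ∀ i → ¬ (x ∈ U i)
    uncovered i x∈U with proj₂ (proj₂ (hull i)) (escape em hulls light) x∈U
    ... | L , eq = escape-avoids em L hulls light i eq

  half-log₃2≤dimH-Y : half log₃2 ≤ᴿ dimH Y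
  half-log₃2≤dimH-Y {mkℚᵘ (ℤ.-[1+ _ ]) _} (s , 0≤s , _ , s<q) with 0≤s s<q
  ... | *<* ()
  -- Either `q` already lies above `half log₃2`, or its powers satisfy the hypothesis under which no
  -- exponent below `q` can be null.
  half-log₃2≤dimH-Y {mkℚᵘ (+ a) b} (s , 0≤s , null , s<q) with 2 ^ suc b ℕ.<? 3 ^ (2 * a)
  ... | yes 2<3 = half-log₃2⇐ {a} {b} (0≤s s<q) 2<3
  ... | no  2≮3 = contradiction null (ℋ-Y≢0 {s} s<q (ℕ.≮⇒≥ 2≮3))

theorem5p1 : ExcludedMiddle 0ℓ →
    ( Y ⊆ Cantor
    × IsPathSetFractal Y
    × dimH Y ≈ᴿ half log₃2
    × (fromℚ (+ 315464 / 1000000) ≤ᴿ half log₃2 × half log₃2 <ℚ (+ 315465 / 1000000))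
    × (∀ k → Y ⊆ 𝒞[1, N (2 * k + 1) ])
    × Y ⊆ (λ x → ∀ k → 1 ≤ k → x ∈ 𝒞[1, N (2 * k + 1) ]) )
    ×
    ( dimH Y ≤ᴿ dimH (λ x → x ∈ Cantor × (∀ k → N (2 * k + 1) · x ∈ Cantor))
    × dimH Y ≈ᴿ half log₃2
    × half log₃2 ≤ᴿ dimH ℰ⋆ )
theorem5p1 em =
    ( (λ {x} → Y⊆Cantor {x})
    , Y-isPathSetFractal
    , dimension
    , ((λ {q} → half-log₃2-lower {q}) , half-log₃2-upper)
    , (λ k {x} → Y⊆𝒞 k {x})
    , (λ {x} x∈Y k _ → Y⊆𝒞 k {x} x∈Y) )
  , ( (λ {q} → dimH-mono (λ {x} x∈Y → Y⊆Cantor {x} x∈Y , λ k → N·Y⊆Cantor k {x} x∈Y) {q})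
    , dimension
    , (λ {q} q∈ → half-log₃2≤dimH-Y em {q} (dimH-mono (λ {x} → Y⊆ℰ⋆ {x}) {q} q∈)) )
  where
  Y⊆𝒞 : ∀ k → Y ⊆ 𝒞[1, N (2 * k + 1) ]
  Y⊆𝒞 k {x} x∈Y = Y⊆Cantor {x} x∈Y , N·Y⊆Cantor k {x} x∈Y
  dimension : dimH Y ≈ᴿ half log₃2
  dimension = (λ {q} → dimH-Y≤half-log₃2 {q}) , (λ {q} → half-log₃2≤dimH-Y em {q})
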